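{- Let $m,n\geq 1$ and let $c_0:V(K_{m,n})\to\mathbb{Z}$ be any initial chip configuration on the complete bipartite graph $K_{m,n}$. Then the sequence of configurations $(c_t)_{t\ge0}$ produced by the diffusion process is eventually periodic, i.e. there exist $t\geq 0$ and $p\geq 1$ with $c_{t+p}=c_t$.
   Context: Diffusion process: for a finite simple graph $G$ and a chip configuration $c_t:V(G)\to\mathbb{Z}$ (negative values allowed), the next configuration is defined simultaneously for every vertex $u$ by $c_{t+1}(u)=c_t(u)-|\{w\in N(u): c_t(u)>c_t(w)\}|+|\{w\in N(u): c_t(u)<c_t(w)\}|$. -}

module Defs where

open import Data.Nat.Base using (ℕ; zero; suc)
import Data.Nat.Base as ℕ
open import Data.Integer.Base using (ℤ; +_; _+_; _-_; _<_; _>_)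
open import Data.Integer.Properties using (_<?_)
open import Data.Fin.Base using (Fin)
open import Data.Fin.Properties using (+↔⊎)
open import Data.List.Base using (List; allFin; filter; length; map)
open import Data.Product.Base using (_×_)
open import Data.Sum.Base using (_⊎_; inj₁; inj₂)
open import Function.Bundles using (_↔_; Inverse)
open import Relation.Binary.Core using (Rel)
open import Relation.Binary.Definitions using (Decidable; Irreflexive; Symmetric)
open import Relation.Binary.PropositionalEquality.Core using (_≡_)
open import Relation.Nullary.Decidable.Core using (yes; no; _×-dec_)
import Relation.Unary as U
open import Level using (0ℓ)

record FiniteSimpleGraph : Set₁ where
  field
    V           : Set
    order       : ℕ
    enumeration : Fin order ↔ V
    Adj         : Rel V 0ℓ
    adj?        : Decidable Adj
    adj-sym     : Symmetric Adj
    adj-irrefl  : Irreflexive _≡_ Adj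

  -- Lists every vertex exactly once, because the enumeration is a bijection.
  vertices : List V
  vertices = map (Inverse.to enumeration) (allFin order)

  card : {P : V → Set} → U.Decidable P → ℕ
  card P? = length (filter P? vertices)

module _ (G : FiniteSimpleGraph) where
  open FiniteSimpleGraph G

  Configuration : Set
  Configuration = V → ℤ

  PoorerNeighbour : Configuration → V → V → Set
  PoorerNeighbour c u w = Adj u w × c u > c w

  RicherNeighbour : Configuration → V → V → Set
  RicherNeighbour c u w = Adj u w × c u < c w

  poorerNeighbour? : ∀ c u → U.Decidable (PoorerNeighbour c u)
  poorerNeighbour? c u w = adj? u w ×-dec (c w <? c u)

  richerNeighbour? : ∀ c u → U.Decidable (RicherNeighbour c u)
  richerNeighbour? c u w = adj? u w ×-dec (c u <? c w)

  step : Configuration → Configuration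
  step c u = c u - + card (poorerNeighbour? c u) + + card (richerNeighbour? c u)

  diffusion : Configuration → ℕ → Configuration
  diffusion c₀ zero    = c₀
  diffusion c₀ (suc t) = step (diffusion c₀ t)

data OppositeSides {A B : Set} : Rel (A ⊎ B) 0ℓ where
  left-right : ∀ {a b} → OppositeSides (inj₁ a) (inj₂ b)
  right-left : ∀ {a b} → OppositeSides (inj₂ b) (inj₁ a)

oppositeSides? : {A B : Set} → Decidable (OppositeSides {A} {B})
oppositeSides? (inj₁ _) (inj₁ _) = no λ ()
oppositeSides? (inj₁ _) (inj₂ _) = yes left-right
oppositeSides? (inj₂ _) (inj₁ _) = yes right-left
oppositeSides? (inj₂ _) (inj₂ _) = no λ ()

oppositeSides-sym : {A B : Set} → Symmetric (OppositeSides {A} {B})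
oppositeSides-sym left-right = right-left
oppositeSides-sym right-left = left-right

oppositeSides-irrefl : {A B : Set} → Irreflexive _≡_ (OppositeSides {A} {B})
oppositeSides-irrefl () left-right
oppositeSides-irrefl () right-left

K : ℕ → ℕ → FiniteSimpleGraph
K m n = record
  { V           = Fin m ⊎ Fin n
  ; order       = m ℕ.+ n
  ; enumeration = +↔⊎
  ; Adj         = OppositeSides
  ; adj?        = oppositeSides?
  ; adj-sym     = oppositeSides-sym
  ; adj-irrefl  = oppositeSides-irrefl
  }

{-# OPTIONS --safe #-}

-- On each side of K_{m,n} the vertices have the same neighbours, so the poorer of two such
-- vertices never gains less than the richer one, and their difference stays bounded by some D.
-- If u and v lie on opposite sides and c u − c v > D, then u exceeds all of its neighbours and
-- v is exceeded by all of its own, so c u − c v does not grow. Hence all differences between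
-- vertices stay bounded, and the pigeonhole principle gives two times at which the
-- configurations agree up to an additive constant. That constant is 0, because diffusion
-- preserves the total number of chips.
module Submission where

open import Defs
open import Data.Nat.Base using (ℕ; _+_; _≥_)
open import Data.Product.Base using (_×_; ∃-syntax)
open import Relation.Binary.PropositionalEquality.Core using (_≗_)

open import Data.Nat.Base using (zero; suc; z≤n; s≤s)
import Data.Nat.Base as ℕ
import Data.Nat.Properties as ℕ
open import Data.Nat.ListAction using (sum)
open import Algebra.Properties.CommutativeSemigroup ℕ.+-commutativeSemigroup using (x∙yz≈y∙xz)
open import Data.Integer.Base as ℤ using (ℤ; +_; 0ℤ; ∣_∣; +≤+)
import Data.Integer.Properties as ℤ
open import Data.Integer.Tactic.RingSolver using (solve-∀)
open import Data.Fin.Base using (Fin; zero; suc; toℕ; fromℕ<; funToFin; finToFun)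
open import Data.Fin.Properties using (pigeonhole; finToFun-funToFin; toℕ-fromℕ<)
open import Data.List.Base using (List; []; _∷_; allFin; filter; foldr; length; map)
open import Data.List.Properties using (filter-none; length-filter; length-map; length-tabulate)
import Data.List.Relation.Unary.All as All
open import Data.Product.Base using (_,_)
open import Data.Sum.Base using (_⊎_; inj₁; inj₂; [_,_]′)
open import Function.Base using (_∘_; id)
open import Function.Bundles using (Inverse)
open import Relation.Binary.PropositionalEquality
  using (_≡_; refl; sym; trans; cong; cong₂; subst; module ≡-Reasoning)
open import Relation.Nullary.Decidable.Core using (yes; no)
open import Relation.Nullary.Negation.Core using (¬_; contradiction)
import Relation.Unary as U

-- Counting with filtered lists.

module _ {A : Set} {P Q : A → Set} (P? : U.Decidable P) (Q? : U.Decidable Q) where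

  length-filter-mono : P U.⊆ Q → ∀ xs → length (filter P? xs) ℕ.≤ length (filter Q? xs)
  length-filter-mono P⊆Q []       = z≤n
  length-filter-mono P⊆Q (x ∷ xs) with P? x | Q? x
  ... | yes _ | yes _ = s≤s (length-filter-mono P⊆Q xs)
  ... | yes p | no ¬q = contradiction (P⊆Q p) ¬q
  ... | no _  | yes _ = ℕ.m≤n⇒m≤1+n (length-filter-mono P⊆Q xs)
  ... | no _  | no _  = length-filter-mono P⊆Q xs

length-filter-empty : {A : Set} {P : A → Set} (P? : U.Decidable P) →
  (∀ x → ¬ P x) → ∀ xs → length (filter P? xs) ≡ 0
length-filter-empty P? ¬p xs = cong length (filter-none P? (All.universal ¬p xs))

module _ {A B : Set} {P : A → B → Set} {Q : B → A → Set}
         (P? : ∀ x → U.Decidable (P x)) (Q? : ∀ y → U.Decidable (Q y))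
         (P⇒Q : ∀ {x y} → P x y → Q y x) (Q⇒P : ∀ {x y} → Q y x → P x y) where

  double-counting-∷ : ∀ x xs ys →
    sum (map (λ y → length (filter (Q? y) (x ∷ xs))) ys) ≡
    length (filter (P? x) ys) + sum (map (λ y → length (filter (Q? y) xs)) ys)
  double-counting-∷ x xs []       = refl
  double-counting-∷ x xs (y ∷ ys) with P? x y | Q? y x
  ... | yes p | no ¬q = contradiction (P⇒Q p) ¬q
  ... | no ¬p | yes q = contradiction (Q⇒P q) ¬p
  ... | yes _ | yes _ = cong suc (trans
    (cong (length (filter (Q? y) xs) ℕ.+_) (double-counting-∷ x xs ys))
    (x∙yz≈y∙xz (length (filter (Q? y) xs)) (length (filter (P? x) ys)) _))
  ... | no _  | no _  = trans
    (cong (length (filter (Q? y) xs) ℕ.+_) (double-counting-∷ x xs ys))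
    (x∙yz≈y∙xz (length (filter (Q? y) xs)) (length (filter (P? x) ys)) _)

  -- Both sides count the pairs `(x , y)` with `P x y`, once grouped by `x` and once by `y`; `P⇒Q`
  -- and `Q⇒P` make `Q` the converse of `P`.
  double-counting : ∀ xs ys →
    sum (map (λ x → length (filter (P? x) ys)) xs) ≡
    sum (map (λ y → length (filter (Q? y) xs)) ys)
  double-counting [] ys = sym (sum-zero ys)
    where
    sum-zero : (ys : List B) → sum (map (λ _ → 0) ys) ≡ 0
    sum-zero []       = refl
    sum-zero (_ ∷ ys) = sum-zero ys
  double-counting (x ∷ xs) ys = trans
    (cong (length (filter (P? x) ys) ℕ.+_) (double-counting xs ys))
    (sym (double-counting-∷ x xs ys))

-- Totals of integer-valued functions.

total : {A : Set} → List A → (A → ℤ) → ℤ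
total xs f = foldr ℤ._+_ 0ℤ (map f xs)

total-net : {A : Set} (f : A → ℤ) (p r : A → ℕ) → ∀ xs →
  total xs (λ x → f x ℤ.- + p x ℤ.+ + r x) ≡
  total xs f ℤ.- + sum (map p xs) ℤ.+ + sum (map r xs)
total-net f p r []       = refl
total-net f p r (x ∷ xs) = trans
  (cong (λ z → f x ℤ.- + p x ℤ.+ + r x ℤ.+ z) (total-net f p r xs))
  (regroup (f x) (+ p x) (+ r x) _ _ _)
  where
  regroup : ∀ a b c d e g → a ℤ.- b ℤ.+ c ℤ.+ (d ℤ.- e ℤ.+ g) ≡ a ℤ.+ d ℤ.- (b ℤ.+ e) ℤ.+ (c ℤ.+ g)
  regroup = solve-∀

total-shift : {A : Set} (f g : A → ℤ) (k : ℤ) → (∀ x → f x ≡ g x ℤ.+ k) → ∀ xs →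
  total xs f ≡ total xs g ℤ.+ k ℤ.* + length xs
total-shift f g k eq [] = sym (trans (ℤ.+-identityˡ (k ℤ.* 0ℤ)) (ℤ.*-zeroʳ k))
total-shift f g k eq (x ∷ xs) = trans
  (cong₂ ℤ._+_ (eq x) (total-shift f g k eq xs))
  (regroup (g x) k (total xs g) (+ length xs))
  where
  regroup : ∀ a k b l → a ℤ.+ k ℤ.+ (b ℤ.+ k ℤ.* l) ≡ a ℤ.+ b ℤ.+ k ℤ.* (+ 1 ℤ.+ l)
  regroup = solve-∀

-- Equal differences from `a` force `f` and `g` to differ by the constant `k = f a - g a`. Comparing
-- totals then gives `k * length xs = 0`, and the integers have no zero divisors.
total-determines : {A : Set} (f g : A → ℤ) (a : A) (xs : List A) → length xs ≥ 1 →
  (∀ x → f x ℤ.- f a ≡ g x ℤ.- g a) → total xs f ≡ total xs g → f ≗ g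
total-determines f g a xs len≥1 shape tot x = begin
  f x          ≡⟨ shifted x ⟩
  g x ℤ.+ k    ≡⟨ cong (λ i → g x ℤ.+ i) k≡0 ⟩
  g x ℤ.+ 0ℤ   ≡⟨ ℤ.+-identityʳ (g x) ⟩
  g x          ∎
  where
  open ≡-Reasoning
  k : ℤ
  k = f a ℤ.- g a
  shifted : ∀ x → f x ≡ g x ℤ.+ k
  shifted x = begin
    f x                          ≡⟨ split (f x) (f a) ⟩
    f x ℤ.- f a ℤ.+ f a          ≡⟨ cong (ℤ._+ f a) (shape x) ⟩
    g x ℤ.- g a ℤ.+ f a          ≡⟨ regroup (g x) (g a) (f a) ⟩
    g x ℤ.+ k                    ∎
    where
    split : ∀ i j → i ≡ i ℤ.- j ℤ.+ j
    split = solve-∀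
    regroup : ∀ i j l → i ℤ.- j ℤ.+ l ≡ i ℤ.+ (l ℤ.- j)
    regroup = solve-∀
  k*len≡0 : k ℤ.* + length xs ≡ 0ℤ
  k*len≡0 = begin
    k ℤ.* + length xs                                  ≡⟨ isolate (total xs g) _ ⟩
    total xs g ℤ.+ k ℤ.* + length xs ℤ.- total xs g    ≡⟨ cong (ℤ._- total xs g) (total-shift f g k shifted xs) ⟨
    total xs f ℤ.- total xs g                          ≡⟨ ℤ.i≡j⇒i-j≡0 tot ⟩
    0ℤ                                                 ∎
    where
    isolate : ∀ i j → j ≡ i ℤ.+ j ℤ.- i
    isolate = solve-∀
  k≡0 : k ≡ 0ℤ
  k≡0 = [ id , (λ len≡0 → contradiction (subst (_≥ 1) (ℤ.+-injective len≡0) len≥1) λ ()) ]′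
          (ℤ.i*j≡0⇒i≡0∨j≡0 k k*len≡0)

-- Recurrence of bounded sequences.

bounded⇒recurrent : ∀ {n} (s : ℕ → Fin n → ℕ) (B : ℕ) → (∀ t i → s t i ℕ.≤ B) →
  ∃[ t ] ∃[ p ] (p ≥ 1 × s (t + p) ≗ s t)
bounded⇒recurrent {n} s B s≤B with pigeonhole (ℕ.n<1+n (suc B ℕ.^ n)) code
  where
  digits : ℕ → Fin n → Fin (suc B)
  digits t i = fromℕ< (s≤s (s≤B t i))
  -- Each `s t` is a word of length `n` over `suc B` letters. Observing one more time than there are
  -- such words forces a repetition.
  code : Fin (suc (suc B ℕ.^ n)) → Fin (suc B ℕ.^ n)
  code t = funToFin (digits (toℕ t))
... | i , j , i<j , eq =
  toℕ i , toℕ j ℕ.∸ toℕ i , ℕ.m<n⇒0<n∸m i<j , λ l →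
  trans (cong (λ t → s t l) (ℕ.m+[n∸m]≡n (ℕ.<⇒≤ i<j))) (sym (decode l))
  where
  digit : ∀ t l → toℕ (finToFun {suc B} {n} (funToFin (λ l → fromℕ< (s≤s (s≤B t l)))) l) ≡ s t l
  digit t l = trans (cong toℕ (finToFun-funToFin (λ l → fromℕ< (s≤s (s≤B t l))) l)) (toℕ-fromℕ< _)
  decode : ∀ l → s (toℕ i) l ≡ s (toℕ j) l
  decode l = trans (sym (digit (toℕ i) l))
    (trans (cong (λ k → toℕ (finToFun {suc B} {n} k l)) eq) (digit (toℕ j) l))

Fin-bounded : ∀ {n} (f : Fin n → ℕ) → ∃[ M ] ∀ i → f i ℕ.≤ M
Fin-bounded {zero}  f = 0 , λ ()
Fin-bounded {suc n} f with Fin-bounded (f ∘ suc)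
... | M , f≤M = f zero + M , λ where
  zero    → ℕ.m≤m+n (f zero) M
  (suc i) → ℕ.m≤n⇒m≤o+n (f zero) (f≤M i)

-- Conservation of chips on a finite simple graph.

module _ (G : FiniteSimpleGraph) where
  open FiniteSimpleGraph G

  vertex : Fin order → V
  vertex = Inverse.to enumeration

  index : V → Fin order
  index = Inverse.from enumeration

  vertex-index : ∀ u → vertex (index u) ≡ u
  vertex-index = Inverse.strictlyInverseˡ enumeration

  length-vertices : length vertices ≡ order
  length-vertices = trans (length-map vertex (allFin order)) (length-tabulate id)

  card≤order : {P : V → Set} (P? : U.Decidable P) → card P? ℕ.≤ order
  card≤order P? = subst (card P? ℕ.≤_) length-vertices (length-filter P? vertices)

  poorer richer : Configuration G → V → ℕ
  poorer c u = card (poorerNeighbour? G c u)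
  richer c u = card (richerNeighbour? G c u)

  -- An edge whose ends differ carries one chip. It is counted by `poorer` at its richer end and by
  -- `richer` at its poorer end, so the two sums agree by `double-counting`.
  step-total : ∀ c → total vertices (step G c) ≡ total vertices c
  step-total c = begin
    total vertices (step G c)
      ≡⟨ total-net c (poorer c) (richer c) vertices ⟩
    total vertices c ℤ.- + sum (map (poorer c) vertices) ℤ.+ + sum (map (richer c) vertices)
      ≡⟨ cong (λ s → total vertices c ℤ.- + s ℤ.+ + sum (map (richer c) vertices)) poorer≡richer ⟩
    total vertices c ℤ.- + sum (map (richer c) vertices) ℤ.+ + sum (map (richer c) vertices)
      ≡⟨ cancel (total vertices c) _ ⟩
    total vertices c ∎
    where
    open ≡-Reasoning
    poorer≡richer : sum (map (poorer c) vertices) ≡ sum (map (richer c) vertices)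
    poorer≡richer = double-counting (poorerNeighbour? G c) (richerNeighbour? G c)
      (λ (adj , lt) → adj-sym adj , lt) (λ (adj , lt) → adj-sym adj , lt) vertices vertices
    cancel : ∀ i j → i ℤ.- j ℤ.+ j ≡ i
    cancel = solve-∀

  diffusion-total : ∀ c t → total vertices (diffusion G c t) ≡ total vertices c
  diffusion-total c zero    = refl
  diffusion-total c (suc t) = trans (step-total (diffusion G c t)) (diffusion-total c t)

  -- Change of differences in one step.

  step-difference : ∀ c u v → step G c u ℤ.- step G c v ≡
    c u ℤ.- c v ℤ.+ (+ (richer c u + poorer c v) ℤ.- + (poorer c u + richer c v))
  step-difference c u v =
    regroup (c u) (+ poorer c u) (+ richer c u) (c v) (+ poorer c v) (+ richer c v)
    where
    regroup : ∀ a p r b q s → a ℤ.- p ℤ.+ r ℤ.- (b ℤ.- q ℤ.+ s) ≡ a ℤ.- b ℤ.+ (r ℤ.+ q ℤ.- (p ℤ.+ s))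
    regroup = solve-∀

  -- Only chips gained by `u` or lost by `v` enlarge the difference, and each of these two counts is
  -- at most `order`.
  step-difference-≤ : ∀ c u v → step G c u ℤ.- step G c v ℤ.≤ c u ℤ.- c v ℤ.+ + (order + order)
  step-difference-≤ c u v = begin
    step G c u ℤ.- step G c v
      ≡⟨ step-difference c u v ⟩
    c u ℤ.- c v ℤ.+ (+ (richer c u + poorer c v) ℤ.- + (poorer c u + richer c v))
      ≤⟨ ℤ.+-monoʳ-≤ (c u ℤ.- c v) (ℤ.i-j≤i _ (+ (poorer c u + richer c v))) ⟩
    c u ℤ.- c v ℤ.+ + (richer c u + poorer c v)
      ≤⟨ ℤ.+-monoʳ-≤ (c u ℤ.- c v) (+≤+ (ℕ.+-mono-≤ (card≤order (richerNeighbour? G c u))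
                                                     (card≤order (poorerNeighbour? G c v)))) ⟩
    c u ℤ.- c v ℤ.+ + (order + order) ∎
    where open ℤ.≤-Reasoning

  step-difference-nonincreasing : ∀ c u v →
    richer c u ℕ.≤ richer c v → poorer c v ℕ.≤ poorer c u →
    step G c u ℤ.- step G c v ℤ.≤ c u ℤ.- c v
  step-difference-nonincreasing c u v r p = begin
    step G c u ℤ.- step G c v
      ≡⟨ step-difference c u v ⟩
    c u ℤ.- c v ℤ.+ (+ (richer c u + poorer c v) ℤ.- + (poorer c u + richer c v))
      ≤⟨ ℤ.+-monoʳ-≤ (c u ℤ.- c v) (ℤ.i≤j⇒i-j≤0 (+≤+ gains)) ⟩
    c u ℤ.- c v ℤ.+ 0ℤ
      ≡⟨ ℤ.+-identityʳ _ ⟩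
    c u ℤ.- c v ∎
    where
    open ℤ.≤-Reasoning
    gains : richer c u + poorer c v ℕ.≤ poorer c u + richer c v
    gains = subst (richer c u + poorer c v ℕ.≤_) (ℕ.+-comm (richer c v) (poorer c u)) (ℕ.+-mono-≤ r p)

  module _ {u v : V} (N⊆ : ∀ {w} → Adj u w → Adj v w) (N⊇ : ∀ {w} → Adj v w → Adj u w) where

    -- If `c u ≤ c v`, a single step lifts the difference from at most 0 to at most `order + order`.
    -- Otherwise, among the common neighbours, those richer than `u` are richer than `v` and those
    -- poorer than `v` are poorer than `u`, so the difference does not grow.
    twins-bounded : ∀ {D} c → order + order ℕ.≤ D →
      c u ℤ.- c v ℤ.≤ + D → step G c u ℤ.- step G c v ℤ.≤ + D
    twins-bounded {D} c 2N≤D close with ℤ.≤-total (c u) (c v)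
    ... | inj₁ cu≤cv = begin
      step G c u ℤ.- step G c v            ≤⟨ step-difference-≤ c u v ⟩
      c u ℤ.- c v ℤ.+ + (order + order)    ≤⟨ ℤ.+-mono-≤ (ℤ.i≤j⇒i-j≤0 cu≤cv) (+≤+ 2N≤D) ⟩
      + D                                  ∎
      where open ℤ.≤-Reasoning
    ... | inj₂ cv≤cu = ℤ.≤-trans
      (step-difference-nonincreasing c u v
        (length-filter-mono (richerNeighbour? G c u) (richerNeighbour? G c v)
          (λ (adj , lt) → N⊆ adj , ℤ.≤-<-trans cv≤cu lt) vertices)
        (length-filter-mono (poorerNeighbour? G c v) (poorerNeighbour? G c u)
          (λ (adj , lt) → N⊇ adj , ℤ.<-≤-trans lt cv≤cu) vertices))
      close

  -- A neighbour of `u` richer than `u` would exceed `v` by more than `D`, and `u` would exceed by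
  -- more than `D` any neighbour of `v` poorer than `v`. Neither exists, so `u` gains nothing and
  -- `v` loses nothing.
  far-nonincreasing : ∀ {D} c u v →
    (∀ w → Adj u w → c w ℤ.- c v ℤ.≤ + D) → (∀ w → Adj v w → c u ℤ.- c w ℤ.≤ + D) →
    + D ℤ.< c u ℤ.- c v → step G c u ℤ.- step G c v ℤ.≤ c u ℤ.- c v
  far-nonincreasing {D} c u v near-v near-u far = step-difference-nonincreasing c u v
    (subst (ℕ._≤ richer c v) (sym (length-filter-empty (richerNeighbour? G c u) no-richer vertices)) z≤n)
    (subst (ℕ._≤ poorer c u) (sym (length-filter-empty (poorerNeighbour? G c v) no-poorer vertices)) z≤n)
    where
    no-richer : ∀ w → ¬ RicherNeighbour G c u w
    no-richer w (adj , cu<cw) = ℤ.<⇒≱ far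
      (ℤ.≤-trans (ℤ.+-monoˡ-≤ (ℤ.- c v) (ℤ.<⇒≤ cu<cw)) (near-v w adj))
    no-poorer : ∀ w → ¬ PoorerNeighbour G c v w
    no-poorer w (adj , cw<cv) = ℤ.<⇒≱ far
      (ℤ.≤-trans (ℤ.+-monoʳ-≤ (c u) (ℤ.neg-mono-≤ (ℤ.<⇒≤ cw<cv))) (near-u w adj))

  differences-bounded : ∀ c → ∃[ M ] ∀ u v → c u ℤ.- c v ℤ.≤ + M
  differences-bounded c with Fin-bounded (∣_∣ ∘ c ∘ vertex)
  ... | M , bound = M + M , λ u v → begin
    c u ℤ.- c v           ≤⟨ i≤+∣i∣ (c u ℤ.- c v) ⟩
    + ∣ c u ℤ.- c v ∣     ≤⟨ +≤+ (ℤ.∣i-j∣≤∣i∣+∣j∣ (c u) (c v)) ⟩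
    + (∣ c u ∣ + ∣ c v ∣) ≤⟨ +≤+ (ℕ.+-mono-≤ (boundV u) (boundV v)) ⟩
    + (M + M)             ∎
    where
    open ℤ.≤-Reasoning
    boundV : ∀ u → ∣ c u ∣ ℕ.≤ M
    boundV u = subst (λ w → ∣ c w ∣ ℕ.≤ M) (vertex-index u) (bound (index u))
    i≤+∣i∣ : ∀ i → i ℤ.≤ + ∣ i ∣
    i≤+∣i∣ (+ n)        = ℤ.≤-refl
    i≤+∣i∣ (ℤ.-[1+ n ]) = ℤ.-≤+

  nonempty : V → length vertices ≥ 1
  nonempty v = subst (_≥ 1) (sym length-vertices) (inhabited (index v))
    where
    inhabited : ∀ {n} → Fin n → n ≥ 1
    inhabited {suc n} _ = s≤s z≤n

  -- From bounded differences to periodicity.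

  module _ (d : ℕ → Configuration G) (C : ℕ) (v₀ : V)
           (bound : ∀ t u v → d t u ℤ.- d t v ℤ.≤ + C) where

    -- Encodes `d t u - d t v₀`, which lies between `- C` and `C`, as a natural number by adding
    -- `C`, so that the pigeonhole argument applies. The absolute value only changes the type, since
    -- `bound` makes its argument nonnegative.
    offset : ℕ → V → ℕ
    offset t u = ∣ + C ℤ.- (d t v₀ ℤ.- d t u) ∣

    +offset : ∀ t u → + offset t u ≡ + C ℤ.- (d t v₀ ℤ.- d t u)
    +offset t u = ℤ.0≤i⇒+∣i∣≡i (ℤ.i≤j⇒0≤j-i (bound t v₀ u))

    offset≤ : ∀ t u → offset t u ℕ.≤ C + C
    offset≤ t u = ℤ.drop‿+≤+ (begin
      + offset t u                         ≡⟨ +offset t u ⟩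
      + C ℤ.- (d t v₀ ℤ.- d t u)           ≡⟨ flip (+ C) (d t v₀) (d t u) ⟩
      + C ℤ.+ (d t u ℤ.- d t v₀)           ≤⟨ ℤ.+-monoʳ-≤ (+ C) (bound t u v₀) ⟩
      + C ℤ.+ + C                          ∎)
      where
      open ℤ.≤-Reasoning
      flip : ∀ k i j → k ℤ.- (i ℤ.- j) ≡ k ℤ.+ (j ℤ.- i)
      flip = solve-∀

    offset-difference : ∀ t u → d t u ℤ.- d t v₀ ≡ + offset t u ℤ.- + C
    offset-difference t u = trans (regroup (+ C) (d t u) (d t v₀))
      (cong (ℤ._- + C) (sym (+offset t u)))
      where
      regroup : ∀ k a b → a ℤ.- b ≡ k ℤ.- (b ℤ.- a) ℤ.- k
      regroup = solve-∀

    shape-recurs : ∀ {t p} → (∀ i → offset (t + p) (vertex i) ≡ offset t (vertex i)) →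
      ∀ u → d (t + p) u ℤ.- d (t + p) v₀ ≡ d t u ℤ.- d t v₀
    shape-recurs {t} {p} recur u = begin
      d (t + p) u ℤ.- d (t + p) v₀    ≡⟨ offset-difference (t + p) u ⟩
      + offset (t + p) u ℤ.- + C      ≡⟨ cong (λ k → + k ℤ.- + C) (recur′ u) ⟩
      + offset t u ℤ.- + C            ≡⟨ offset-difference t u ⟨
      d t u ℤ.- d t v₀                ∎
      where
      open ≡-Reasoning
      recur′ : ∀ u → offset (t + p) u ≡ offset t u
      recur′ u = subst (λ w → offset (t + p) w ≡ offset t w) (vertex-index u) (recur (index u))

    bounded⇒shape-recurrent :
      ∃[ t ] ∃[ p ] (p ≥ 1 × ∀ u → d (t + p) u ℤ.- d (t + p) v₀ ≡ d t u ℤ.- d t v₀)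
    bounded⇒shape-recurrent =
      let t , p , p≥1 , recur = bounded⇒recurrent (λ t → offset t ∘ vertex) (C + C) (λ t i → offset≤ t (vertex i))
      in t , p , p≥1 , shape-recurs recur

  bounded⇒periodic : ∀ c₀ C → V → (∀ t u v → diffusion G c₀ t u ℤ.- diffusion G c₀ t v ℤ.≤ + C) →
    ∃[ t ] ∃[ p ] (p ≥ 1 × diffusion G c₀ (t + p) ≗ diffusion G c₀ t)
  bounded⇒periodic c₀ C v₀ bound =
    let t , p , p≥1 , shape = bounded⇒shape-recurrent (diffusion G c₀) C v₀ bound
    -- `v₀` serves both as the reference vertex of the shape and as the witness that there is a
    -- vertex, which excludes a nonzero shift between configurations of equal total.
    in t , p , p≥1 , total-determines _ _ v₀ vertices (nonempty v₀) shape
         (trans (diffusion-total c₀ (t + p)) (sym (diffusion-total c₀ t)))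

-- Complete bipartite graphs.

opposite-trans : {A B : Set} {u v w : A ⊎ B} →
  ¬ OppositeSides u v → OppositeSides u w → OppositeSides v w
opposite-trans {u = inj₁ _} {inj₁ _} _      left-right = left-right
opposite-trans {u = inj₁ _} {inj₂ _} same   left-right = contradiction left-right same
opposite-trans {u = inj₂ _} {inj₁ _} same   right-left = contradiction right-left same
opposite-trans {u = inj₂ _} {inj₂ _} _      right-left = right-left

common-neighbour⇒same : {A B : Set} {u v w : A ⊎ B} →
  OppositeSides u v → OppositeSides u w → ¬ OppositeSides v w
common-neighbour⇒same left-right left-right ()
common-neighbour⇒same right-left right-left ()

module _ (m n : ℕ) where
  private
    G = K m n
  open FiniteSimpleGraph G

  -- The invariant of the process. The slack `order + order` in `any` is the bound on one-step
  -- growth: a difference across the sides may overshoot `D` by one step, after which it cannot grow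
  -- while it exceeds `D`.
  record Spread (D : ℕ) (c : Configuration G) : Set where
    field
      same : ∀ u v → ¬ Adj u v → c u ℤ.- c v ℤ.≤ + D
      any  : ∀ u v → c u ℤ.- c v ℤ.≤ + (D + (order + order))
  open Spread

  step-spread : ∀ {D} c → order + order ℕ.≤ D → Spread D c → Spread D (step G c)
  step-spread {D} c 2N≤D sp = record { same = same′ ; any = any′ }
    where
    same′ : ∀ u v → ¬ Adj u v → step G c u ℤ.- step G c v ℤ.≤ + D
    -- Non-adjacent vertices lie on one side, so their neighbourhoods coincide.
    same′ u v ¬adj = twins-bounded G (opposite-trans ¬adj)
      (opposite-trans (¬adj ∘ adj-sym)) c 2N≤D (same sp u v ¬adj)
    any′ : ∀ u v → step G c u ℤ.- step G c v ℤ.≤ + (D + (order + order))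
    any′ u v with adj? u v
    ... | no ¬adj = ℤ.≤-trans (same′ u v ¬adj) (+≤+ (ℕ.m≤m+n D _))
    ... | yes adj with c u ℤ.- c v ℤ.≤? + D
    ...   | yes close = ℤ.≤-trans (step-difference-≤ G c u v) (ℤ.+-monoˡ-≤ (+ (order + order)) close)
    ...   | no ¬close = ℤ.≤-trans
      -- As `u` and `v` are adjacent, neighbours of `u` lie on the side of `v` and neighbours of `v`
      -- on that of `u`; `same` therefore supplies both closeness hypotheses.
      (far-nonincreasing G c u v
        (λ w adj′ → same sp w v (common-neighbour⇒same adj′ adj))
        (λ w adj′ → same sp u w (common-neighbour⇒same (adj-sym adj) adj′))
        (ℤ.≰⇒> ¬close))
      (any sp u v)

  diffusion-spread : ∀ {D} c → order + order ℕ.≤ D → Spread D c → ∀ t → Spread D (diffusion G c t)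
  diffusion-spread c 2N≤D sp zero    = sp
  diffusion-spread c 2N≤D sp (suc t) = step-spread _ 2N≤D (diffusion-spread c 2N≤D sp t)

theorem13 : (m n : ℕ) → m ≥ 1 → n ≥ 1 → (c₀ : Configuration (K m n)) →
    ∃[ t ] ∃[ p ] (p ≥ 1 × diffusion (K m n) c₀ (t + p) ≗ diffusion (K m n) c₀ t)
-- Matching `m` as a successor provides the reference vertex `inj₁ zero`.
theorem13 m@(suc _) n _ _ c₀ with differences-bounded (K m n) c₀
... | M , bound = bounded⇒periodic (K m n) c₀ (D + 2N) (inj₁ zero)
  (λ t → Spread.any (diffusion-spread m n c₀ (ℕ.m≤n+m 2N M) initial t))
  where
  2N = (m + n) + (m + n)
  -- `M` covers the initial differences, and the summand `2N` ensures the lower bound on `D` under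
  -- which `Spread` is preserved.
  D = M + 2N
  initial : Spread m n D c₀
  initial = record
    { same = λ u v _ → ℤ.≤-trans (bound u v) (+≤+ (ℕ.m≤m+n M 2N))
    ; any  = λ u v → ℤ.≤-trans (bound u v) (+≤+ (ℕ.m≤n⇒m≤n+o 2N (ℕ.m≤m+n M 2N)))
    }
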